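{- Assume Dickson's conjecture. Then the set \[ \left\{ \frac{\varphi(p+1)}{\varphi(p)} \,:\, p \text{ and } p+2 \text{ are both prime} \right\} \] is dense in $\left[0,\tfrac{1}{3}\right]$.
   Context: $\varphi$ denotes Euler's totient function. Dickson's conjecture is the following assertion: if $f_1,\dots,f_k \in \mathbb{Z}[t]$ are linear polynomials with positive leading coefficients and the product $f=f_1f_2\cdots f_k$ does not vanish identically modulo any prime (i.e., for every prime $q$ there is an integer $t$ with $q \nmid f(t)$), then there are infinitely many positive integers $t$ for which $f_1(t),\dots,f_k(t)$ are simultaneously prime. -}

module Defs where

open import Data.Integer.Base as ℤ using (ℤ; +_; 1ℤ)
open import Data.Integer.Divisibility as ℤ using ()
open import Data.List.Base using (List; length; filter; applyUpTo; map; foldr)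
open import Data.List.Properties using (filter-accept)
open import Data.List.Relation.Unary.All using (All)
open import Data.Nat.Base as ℕ using (ℕ; suc; NonZero)
open import Data.Nat.Coprimality using (Coprime; coprime?; 1-coprimeTo)
open import Data.Nat.Primality using (Prime; prime⇒nonZero)
open import Data.Product.Base using (_×_; _,_; ∃-syntax; Σ-syntax)
open import Data.Rational.Base as ℚ using (ℚ; 0ℚ; 1ℚ; _/_; _<_)
open import Data.Rational.Properties as ℚ
  using (<-dense; <-trans; <-irrefl; ≤-<-trans; ≮⇒≥; _<?_)
open import Data.Sum.Base using (_⊎_; inj₁; inj₂)
open import Level using (0ℓ)
open import Relation.Binary.PropositionalEquality.Core
  using (_≡_; refl; sym; cong; subst)
open import Relation.Nullary using (¬_; yes; no)
open import Relation.Unary using (Pred; _∈_)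

φ : ℕ → ℕ
φ n = length (filter (λ k → coprime? k n) (applyUpTo suc n))

φ-nonZero : ∀ n .{{_ : NonZero n}} → NonZero (φ n)
φ-nonZero n@(suc m) = subst NonZero
  (sym (cong length (filter-accept (λ k → coprime? k n)
    {xs = applyUpTo (λ k → suc (suc k)) m} (1-coprimeTo n)))) _

record LinearPoly : Set where
  field
    leading  : ℤ
    constant : ℤ
    leading-positive : ℤ.Positive leading

open LinearPoly public

eval : ℤ → LinearPoly → ℤ
eval t f = leading f ℤ.* t ℤ.+ constant f

evalProduct : ℤ → List LinearPoly → ℤ
evalProduct t fs = foldr ℤ._*_ 1ℤ (map (eval t) fs)

IsPrimeℤ : ℤ → Set
IsPrimeℤ z = ∃[ n ] (z ≡ + n × Prime n)

InfinitelyMany : (ℕ → Set) → Set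
InfinitelyMany P = ∀ N → ∃[ t ] (N ℕ.< t × P t)

DicksonConjecture : Set
DicksonConjecture =
  (fs : List LinearPoly) →
  (∀ q → Prime q → ∃[ t ] ¬ ((+ q) ℤ.∣ evalProduct t fs)) →
  InfinitelyMany (λ t → All (λ f → IsPrimeℤ (eval (+ t) f)) fs)

totientRatio : (p : ℕ) → Prime p → ℚ
totientRatio p prime-p = (+ φ (p ℕ.+ 1) / φ p)
  {{φ-nonZero p {{prime⇒nonZero prime-p}}}}

TwinPrimeTotientRatios : Pred ℚ 0ℓ
TwinPrimeTotientRatios r =
  ∃[ p ] Σ[ prime-p ∈ Prime p ] (Prime (p ℕ.+ 2) × r ≡ totientRatio p prime-p)

-- Two-sided Dedekind cuts: Lower q means q < x, and Upper q means x < q.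
record ℝ : Set₁ where
  field
    Lower Upper     : Pred ℚ 0ℓ
    lower-inhabited : ∃[ q ] q ∈ Lower
    upper-inhabited : ∃[ q ] q ∈ Upper
    lower-closed    : ∀ {q r} → q < r → r ∈ Lower → q ∈ Lower
    upper-closed    : ∀ {q r} → q < r → q ∈ Upper → r ∈ Upper
    lower-open      : ∀ {q} → q ∈ Lower → ∃[ r ] (q < r × r ∈ Lower)
    upper-open      : ∀ {r} → r ∈ Upper → ∃[ q ] (q < r × q ∈ Upper)
    disjoint        : ∀ {q} → ¬ (q ∈ Lower × q ∈ Upper)
    located         : ∀ {q r} → q < r → q ∈ Lower ⊎ r ∈ Upper

open ℝ public

fromℚ : ℚ → ℝ
fromℚ x = record
  { Lower           = _< x
  ; Upper           = x <_
  ; lower-inhabited = x ℚ.+ ℚ.- 1ℚ ,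
      subst (x ℚ.+ ℚ.- 1ℚ <_) (ℚ.+-identityʳ x)
        (ℚ.+-monoʳ-< x (ℚ.negative⁻¹ (ℚ.- 1ℚ)))
  ; upper-inhabited = x ℚ.+ 1ℚ ,
      subst (_< x ℚ.+ 1ℚ) (ℚ.+-identityʳ x)
        (ℚ.+-monoʳ-< x (ℚ.positive⁻¹ 1ℚ))
  ; lower-closed    = <-trans
  ; upper-closed    = λ q<r x<q → <-trans x<q q<r
  ; lower-open      = <-dense
  ; upper-open      = λ x<r → let q , x<q , q<r = <-dense x<r in q , q<r , x<q
  ; disjoint        = λ (q<x , x<q) → <-irrefl refl (<-trans q<x x<q)
  ; located         = located′
  }
  where
  located′ : ∀ {q r} → q < r → q < x ⊎ x < r
  located′ {q} q<r with q <? x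
  ... | yes q<x = inj₁ q<x
  ... | no  q≮x = inj₂ (≤-<-trans (≮⇒≥ q≮x) q<r)

infix 4 _≤ᴿ_

_≤ᴿ_ : ℝ → ℝ → Set
x ≤ᴿ y = ∀ {q} → q ∈ Lower x → q ∈ Lower y

ClosedInterval : ℝ → ℝ → Pred ℝ 0ℓ
ClosedInterval a b x = a ≤ᴿ x × x ≤ᴿ b

-- The closure of S in ℝ contains A; S need not be a subset of A.  Open
-- intervals with rational endpoints form a base of the topology of ℝ.
_IsDenseIn_ : Pred ℚ 0ℓ → Pred ℝ 0ℓ → Set₁
S IsDenseIn A =
  ∀ x → x ∈ A → ∀ a b → a ∈ Lower x → b ∈ Upper x →
  ∃[ s ] (s ∈ S × a < s × s < b)

{-# OPTIONS --safe #-}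

-- Let m be a product of distinct primes greater than 3.  Dickson's conjecture for
-- t, 6 m t - 1, 6 m t + 1 provides twin primes p, p + 2 with p + 1 = 6 m t and t
-- a large prime, so that φ (p + 1) / φ p = φ (6 m) (t - 1) / (6 m t - 2) is
-- just below φ (6 m) / (6 m) = ∏ (1 - 1/q) / 3, the product being over q ∣ m.
-- Multiplying 1 - 1/q over consecutive primes q > K gives small steps when
-- K is large, and the partial products tend to 0 because the harmonic series
-- diverges; hence these values are dense in [0 , 1/3].
module Submission where

open import Defs
open import Data.Bool.Base using (true; false; if_then_else_)
open import Data.Fin.Base using (toℕ)
open import Data.Fin.Properties using (toℕ<n)
open import Data.Integer.Base as ℤ using (ℤ; -[1+_])
import Data.Integer.Divisibility as Unsigned
open import Data.Integer.Divisibility.Signed as Signed using (∣ᵤ⇒∣; ∣⇒∣ᵤ)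
open import Data.Integer.Properties as ℤ using ()
import Data.Integer.Tactic.RingSolver as ℤSolver
open import Data.List.Base using (List; []; _∷_; length; filter; applyUpTo)
open import Data.List.Relation.Unary.All using ([]; _∷_)
open import Data.Nat.Base as ℕ hiding (_/_)
open import Data.Nat.Coprimality as Coprimality
  using (Coprime; coprime?; coprime-divisor; coprime-Bézout)
open import Data.Nat.Divisibility
open import Data.Nat.DivMod using (m*n/n≡m; m*[n/m]≡n; m/n*n≡m; /-monoʳ-≤)
open import Data.Nat.GCD using (module Bézout)
open import Data.Nat.Primality
open import Data.Nat.Primality.Factorisation using (factorise)
open import Data.Nat.Properties
open import Data.Nat.Tactic.RingSolver using (solve-∀)
open import Data.Product.Base using (_×_; _,_; ∃-syntax)
open import Data.Rational.Base as ℚ using (ℚ; mkℚ; 0ℚ; ↥_; ↧_; ↧ₙ_; _/_)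
open import Data.Rational.Properties as ℚ using (toℚᵘ-cancel-<; toℚᵘ-fromℚᵘ)
open import Data.Rational.Unnormalised.Base using (mkℚᵘ; *<*)
import Data.Rational.Unnormalised.Properties as ℚᵘ
open import Data.Sum.Base using (_⊎_; inj₁; inj₂; [_,_]′)
open import Function.Base using (_∘_; id)
open import Relation.Binary.Definitions using (tri<; tri≈; tri>)
open import Relation.Binary.PropositionalEquality
open import Relation.Nullary using (¬_; Dec; does; yes; no; contradiction; _×-dec_)
open import Relation.Unary using (Pred; Decidable; _∈_)
import Algebra.Properties.CommutativeMonoid.Sum +-0-commutativeMonoid as Sum
import Algebra.Properties.Semiring.Sum +-*-semiring as SemiringSum

-- Finite sums over initial segments of ℕ

-- Summing over `Fin n` gives access to the general theorems on sums in monoids and semirings, while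
-- a summand defined on all of ℕ keeps index shifts ordinary arithmetic.
∑ : ℕ → (ℕ → ℕ) → ℕ
∑ n f = Sum.sum {n} (λ i → f (toℕ i))

∑-cong : ∀ n {f g} → (∀ i → i < n → f i ≡ g i) → ∑ n f ≡ ∑ n g
∑-cong n eq = Sum.sum-cong-≗ {n} (λ i → eq (toℕ i) (toℕ<n i))

∑-mono-≤ : ∀ n {f g} → (∀ i → i < n → f i ≤ g i) → ∑ n f ≤ ∑ n g
∑-mono-≤ zero    f≤g = z≤n
∑-mono-≤ (suc n) f≤g = +-mono-≤ (f≤g 0 z<s) (∑-mono-≤ n (λ i i<n → f≤g (suc i) (s<s i<n)))

∑-const : ∀ n c → ∑ n (λ _ → c) ≡ n * c
∑-const zero    c = refl
∑-const (suc n) c = cong (c +_) (∑-const n c)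

∑-zero : ∀ n {f} → (∀ i → i < n → f i ≡ 0) → ∑ n f ≡ 0
∑-zero n f≡0 = trans (∑-cong n f≡0) (trans (∑-const n 0) (*-zeroʳ n))

∑-+ : ∀ m n f → ∑ (m + n) f ≡ ∑ m f + ∑ n (λ i → f (m + i))
∑-+ zero    n f = refl
∑-+ (suc m) n f = trans (cong (f 0 +_) (∑-+ m n (f ∘ suc))) (sym (+-assoc (f 0) _ _))

∑-distrib-+ : ∀ n f g → ∑ n (λ i → f i + g i) ≡ ∑ n f + ∑ n g
∑-distrib-+ n f g = Sum.∑-distrib-+ {n} (f ∘ toℕ) (g ∘ toℕ)

∑-comm : ∀ m n (f : ℕ → ℕ → ℕ) →
         ∑ m (λ i → ∑ n (f i)) ≡ ∑ n (λ j → ∑ m (λ i → f i j))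
∑-comm m n f = Sum.∑-comm {m} {n} (λ i j → f (toℕ i) (toℕ j))

∑-*ʳ : ∀ n f c → ∑ n f * c ≡ ∑ n (λ i → f i * c)
∑-*ʳ n f c = SemiringSum.*-distribʳ-sum {n} c (f ∘ toℕ)

∑-last : ∀ n f → ∑ (suc n) f ≡ ∑ n f + f n
∑-last n f = begin
  ∑ (suc n) f                      ≡⟨ cong (λ k → ∑ k f) (+-comm n 1) ⟨
  ∑ (n + 1) f                      ≡⟨ ∑-+ n 1 f ⟩
  ∑ n f + (f (n + 0) + 0)          ≡⟨ cong (∑ n f +_) (trans (+-identityʳ _) (cong f (+-identityʳ n))) ⟩
  ∑ n f + f n                      ∎
  where open ≡-Reasoning

∑-periodic : ∀ k L f → (∀ i → f (L + i) ≡ f i) → ∑ (k * L) f ≡ k * ∑ L f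
∑-periodic zero    L f periodic = refl
∑-periodic (suc k) L f periodic = begin
  ∑ (L + k * L) f                        ≡⟨ ∑-+ L (k * L) f ⟩
  ∑ L f + ∑ (k * L) (λ i → f (L + i))    ≡⟨ cong (∑ L f +_) (∑-cong (k * L) (λ i _ → periodic i)) ⟩
  ∑ L f + ∑ (k * L) f                    ≡⟨ cong (∑ L f +_) (∑-periodic k L f periodic) ⟩
  ∑ L f + k * ∑ L f                      ∎
  where open ≡-Reasoning

-- Counting with indicators

indicator : ∀ {P : Set} → Dec P → ℕ
indicator P? = if does P? then 1 else 0

indicator-no : ∀ {P : Set} (P? : Dec P) → ¬ P → indicator P? ≡ 0
indicator-no (yes p) ¬p = contradiction p ¬p
indicator-no (no _)  ¬p = refl

indicator-yes : ∀ {P : Set} (P? : Dec P) → P → indicator P? ≡ 1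
indicator-yes (yes _) p = refl
indicator-yes (no ¬p) p = contradiction p ¬p

indicator-cong : ∀ {P Q : Set} (P? : Dec P) (Q? : Dec Q) →
                 (P → Q) → (Q → P) → indicator P? ≡ indicator Q?
indicator-cong P? (yes q) _   Q⇒P = indicator-yes P? (Q⇒P q)
indicator-cong P? (no ¬q) P⇒Q _   = indicator-no P? (¬q ∘ P⇒Q)

indicator-× : ∀ {P Q : Set} (P? : Dec P) (Q? : Dec Q) →
              indicator P? * indicator Q? ≡ indicator (P? ×-dec Q?)
indicator-× (yes _) Q? = +-identityʳ _
indicator-× (no _)  Q? = refl

length-filter-applyUpTo : ∀ {P : Pred ℕ _} (P? : Decidable P) f n →
  length (filter P? (applyUpTo f n)) ≡ ∑ n (λ i → indicator (P? (f i)))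
length-filter-applyUpTo P? f zero = refl
length-filter-applyUpTo P? f (suc n) with does (P? (f 0))
... | true  = cong suc (length-filter-applyUpTo P? (f ∘ suc) n)
... | false = length-filter-applyUpTo P? (f ∘ suc) n

∑-unique : ∀ n {P : Pred ℕ _} (P? : Decidable P) →
  (∀ i j → i < n → j < n → P i → P j → i ≡ j) → ∑ n (λ i → indicator (P? i)) ≤ 1
∑-unique zero    P? unique = z≤n
∑-unique (suc n) P? unique with P? 0
... | yes p = ≤-reflexive (cong suc (∑-zero n (λ i i<n →
        indicator-no (P? (suc i)) (λ q → 0≢1+n (unique 0 (suc i) z<s (s<s i<n) p q)))))
... | no _  = ∑-unique n (P? ∘ suc) (λ i j i<n j<n p q →
        suc-injective (unique (suc i) (suc j) (s<s i<n) (s<s j<n) p q))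

-- Cut the range into blocks of `q` consecutive integers: only the last of each block is a multiple
-- of `q`. The induction on `n` replaces `f` by its shift by `q`.
∑-multiples : ∀ q .{{_ : NonZero q}} n (f : ℕ → ℕ) →
  ∑ (n * q) (λ i → indicator (q ∣? suc i) * f (suc i)) ≡ ∑ n (λ i → f (suc i * q))
∑-multiples q zero f = refl
∑-multiples q@(suc r) (suc n) f = begin
  ∑ (q + n * q) g
    ≡⟨ ∑-+ q (n * q) g ⟩
  ∑ q g + ∑ (n * q) (λ i → g (q + i))
    ≡⟨ cong₂ _+_ first (∑-cong (n * q) (λ i _ → shift i)) ⟩
  f (1 * q) + ∑ (n * q) (λ i → indicator (q ∣? suc i) * f (q + suc i))
    ≡⟨ cong (f (1 * q) +_) (∑-multiples q n (f ∘ (q +_))) ⟩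
  f (1 * q) + ∑ n (λ i → f (suc (suc i) * q))
    ∎
  where
  open ≡-Reasoning
  g : ℕ → ℕ
  g i = indicator (q ∣? suc i) * f (suc i)
  first : ∑ q g ≡ f (1 * q)
  first = begin
    ∑ q g                          ≡⟨ ∑-last r g ⟩
    ∑ r g + g r                    ≡⟨ cong (_+ g r) (∑-zero r (λ i i<r →
                                        cong (_* f (suc i)) (indicator-no (q ∣? suc i) (>⇒∤ (s<s i<r))))) ⟩
    indicator (q ∣? q) * f q       ≡⟨ cong (_* f q) (indicator-yes (q ∣? q) ∣-refl) ⟩
    1 * f q                        ≡⟨ *-identityˡ (f q) ⟩
    f q                            ≡⟨ cong f (*-identityˡ q) ⟨
    f (1 * q)                      ∎
  shift : ∀ i → g (q + i) ≡ indicator (q ∣? suc i) * f (q + suc i)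
  shift i = begin
    indicator (q ∣? suc (q + i)) * f (suc (q + i))
      ≡⟨ cong (λ k → indicator (q ∣? k) * f k) (+-suc q i) ⟨
    indicator (q ∣? (q + suc i)) * f (q + suc i)
      ≡⟨ cong (_* f (q + suc i)) (indicator-cong (q ∣? (q + suc i)) (q ∣? suc i)
           (λ d → ∣m+n∣m⇒∣n d ∣-refl) (∣m∣n⇒∣m+n ∣-refl)) ⟩
    indicator (q ∣? suc i) * f (q + suc i)
      ∎

-- Euler's totient function at products with a new prime

coprimeTo : ℕ → ℕ → ℕ
coprimeTo n k = indicator (coprime? k n)

φ-∑ : ∀ n → φ n ≡ ∑ n (coprimeTo n ∘ suc)
φ-∑ n = length-filter-applyUpTo (λ k → coprime? k n) suc n

∑-coprimeTo : ∀ k n → ∑ (k * n) (coprimeTo n ∘ suc) ≡ k * φ n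
∑-coprimeTo k n = trans (∑-periodic k n _ periodic) (cong (k *_) (sym (φ-∑ n)))
  where
  periodic : ∀ i → coprimeTo n (suc (n + i)) ≡ coprimeTo n (suc i)
  periodic i rewrite sym (+-suc n i) = indicator-cong (coprime? (n + suc i) n) (coprime? (suc i) n)
    (λ c (d∣i , d∣n) → c (∣m∣n⇒∣m+n d∣n d∣i , d∣n))
    Coprimality.coprime-+

prime∤⇒coprime : ∀ {q m} → Prime q → ¬ q ∣ m → Coprime q m
prime∤⇒coprime q-prime q∤m (d∣q , d∣m) with prime⇒irreducible q-prime d∣q
... | inj₁ d≡1  = d≡1
... | inj₂ refl = contradiction d∣m q∤m

coprime-*ʳ : ∀ {k m n} → Coprime k m → Coprime k n → Coprime k (m * n)
coprime-*ʳ km kn (d∣k , d∣mn) =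
  kn (d∣k , coprime-divisor (λ (e∣d , e∣m) → km (∣-trans e∣d d∣k , e∣m)) d∣mn)

-- Among the numbers up to `m * q`, exactly `q * φ m` are coprime to `m`. Each of them is either
-- coprime to `m * q` or a multiple `k * q`; in the latter case `k ≤ m` is coprime to `m`, which
-- gives `φ m` numbers. Adding `φ m` to both sides avoids subtraction.
φ-*-prime : ∀ {q m} → Prime q → ¬ q ∣ m → φ (m * q) ≡ φ m * pred q
φ-*-prime {zero}     {m} q-prime q∤m = contradiction q-prime ¬prime[0]
φ-*-prime {q@(suc r)} {m} q-prime q∤m = +-cancelʳ-≡ (φ m) _ _ (begin
  φ (m * q) + φ m
    ≡⟨ cong₂ _+_ (φ-∑ (m * q)) (φ-∑ m) ⟩
  ∑ (m * q) (coprimeTo (m * q) ∘ suc) + ∑ m (coprimeTo m ∘ suc)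
    ≡⟨ cong (∑ (m * q) (coprimeTo (m * q) ∘ suc) +_) (∑-cong m (λ i _ → unscale (suc i))) ⟨
  ∑ (m * q) (coprimeTo (m * q) ∘ suc) + ∑ m (λ i → coprimeTo m (suc i * q))
    ≡⟨ cong (∑ (m * q) (coprimeTo (m * q) ∘ suc) +_) (∑-multiples q m (coprimeTo m)) ⟨
  ∑ (m * q) (coprimeTo (m * q) ∘ suc)
    + ∑ (m * q) (λ i → indicator (q ∣? suc i) * coprimeTo m (suc i))
    ≡⟨ ∑-distrib-+ (m * q) (coprimeTo (m * q) ∘ suc) (λ i → indicator (q ∣? suc i) * coprimeTo m (suc i)) ⟨
  ∑ (m * q) (λ i → coprimeTo (m * q) (suc i) + indicator (q ∣? suc i) * coprimeTo m (suc i))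
    ≡⟨ ∑-cong (m * q) (λ i _ → split (suc i) (q ∣? suc i)) ⟩
  ∑ (m * q) (coprimeTo m ∘ suc)
    ≡⟨ cong (λ n → ∑ n (coprimeTo m ∘ suc)) (*-comm m q) ⟩
  ∑ (q * m) (coprimeTo m ∘ suc)
    ≡⟨ ∑-coprimeTo q m ⟩
  q * φ m
    ≡⟨ trans (+-comm (φ m) (r * φ m)) (cong (_+ φ m) (*-comm r (φ m))) ⟩
  φ m * r + φ m
    ∎)
  where
  open ≡-Reasoning
  unscale : ∀ k → coprimeTo m (k * q) ≡ coprimeTo m k
  unscale k = indicator-cong (coprime? (k * q) m) (coprime? k m)
    (λ c (d∣k , d∣m) → c (∣m⇒∣m*n q d∣k , d∣m))
    (λ c → Coprimality.sym (coprime-*ʳ (Coprimality.sym c) (Coprimality.sym (prime∤⇒coprime q-prime q∤m))))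
  split : ∀ k → Dec (q ∣ k) →
          coprimeTo (m * q) k + indicator (q ∣? k) * coprimeTo m k ≡ coprimeTo m k
  split k (yes q∣k) = trans
    (cong₂ (λ a b → a + b * coprimeTo m k)
      (indicator-no (coprime? k (m * q)) (λ c → ¬prime[1] (subst Prime (c (q∣k , n∣m*n m)) q-prime)))
      (indicator-yes (q ∣? k) q∣k))
    (*-identityˡ (coprimeTo m k))
  split k (no q∤k) = begin
    coprimeTo (m * q) k + indicator (q ∣? k) * coprimeTo m k
      ≡⟨ cong₂ (λ a b → a + b * coprimeTo m k)
           (indicator-cong (coprime? k (m * q)) (coprime? k m)
             (λ c (d∣k , d∣m) → c (d∣k , ∣m⇒∣m*n q d∣m))
             (λ c → coprime-*ʳ c (Coprimality.sym (prime∤⇒coprime q-prime q∤k))))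
           (indicator-no (q ∣? k) q∤k) ⟩
    coprimeTo m k + 0
      ≡⟨ +-identityʳ _ ⟩
    coprimeTo m k
      ∎

φ-prime : ∀ {p} → Prime p → φ p ≡ pred p
φ-prime {p} p-prime = begin
  φ p            ≡⟨ cong φ (*-identityˡ p) ⟨
  φ (1 * p)      ≡⟨ φ-*-prime p-prime (λ p∣1 → ¬prime[1] (subst Prime (∣1⇒≡1 p∣1) p-prime)) ⟩
  1 * pred p     ≡⟨ *-identityˡ (pred p) ⟩
  pred p         ∎
  where open ≡-Reasoning

-- Harmonic sums and the quotient L / φ(L)

prime-factor : ∀ n .{{_ : NonZero n}} → n ≢ 1 → ∃[ p ] (Prime p × p ∣ n)
prime-factor n n≢1 with factorise n
... | record { factors = [] ; isFactorisation = n≡1 } = contradiction n≡1 n≢1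
... | record { factors = p ∷ ps ; isFactorisation = n≡ ; factorsPrime = p-prime ∷ _ } =
  p , p-prime , subst (p ∣_) (sym n≡) (m∣m*n _)

module _ (N L : ℕ) (primes∣L : ∀ {p} → Prime p → p ≤ N → p ∣ L) where

  -- A prime factor of a common divisor would be at most `N`, hence would divide `L` as well as `k`.
  coprimeTo-≤ : ∀ {n k} .{{_ : NonZero n}} → n ≤ N → Coprime k L → Coprime n k
  coprimeTo-≤ {n} n≤N c {d} (d∣n , d∣k) with d ≟ 1
  ... | yes d≡1 = d≡1
  ... | no  d≢1
    with p , p-prime , p∣d ← prime-factor d {{≢-nonZero (λ { refl → ≢-nonZero⁻¹ n (0∣⇒≡0 d∣n) })}} d≢1 =
    contradiction (subst Prime (c (∣-trans p∣d d∣k , primes∣L p-prime p≤N)) p-prime) ¬prime[1]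
    where
    p≤N : p ≤ N
    p≤N = ≤-trans (∣⇒≤ (∣-trans p∣d d∣n)) n≤N

  -- Here `m` is coprime to `l`. Used in both directions on two factorisations of one number, this
  -- forces their factors up to `N` to agree.
  smoothPart-∣ : ∀ {m n l} k .{{_ : NonZero m}} → m ≤ N → Coprime l L → k * m ≡ l * n → m ∣ n
  smoothPart-∣ k m≤N l⊥L km≡ln =
    coprime-divisor (coprimeTo-≤ m≤N l⊥L) (divides k (sym km≡ln))

  -- Each number has at most one factorisation n * k with n ≤ N and k coprime
  -- to L; the left-hand side counts the x ≤ D * L that have one.
  ∑-/-*-φ≤ : ∀ D → (∀ {n} → n < N → suc n ∣ D) → ∑ N (λ i → D ℕ./ suc i) * φ L ≤ D * L
  ∑-/-*-φ≤ D n∣D = begin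
    ∑ N (λ i → D ℕ./ suc i) * φ L
      ≡⟨ ∑-*ʳ N (λ i → D ℕ./ suc i) (φ L) ⟩
    ∑ N (λ i → D ℕ./ suc i * φ L)
      ≡⟨ ∑-cong N (λ i i<N → block i i<N) ⟩
    ∑ N (λ i → ∑ (D * L) (λ x → indicator (factorisation? x i)))
      ≡⟨ ∑-comm N (D * L) (λ i x → indicator (factorisation? x i)) ⟩
    ∑ (D * L) (λ x → ∑ N (λ i → indicator (factorisation? x i)))
      ≤⟨ ∑-mono-≤ (D * L) (λ x _ → ∑-unique N (factorisation? x) unique) ⟩
    ∑ (D * L) (λ _ → 1)
      ≡⟨ trans (∑-const (D * L) 1) (*-identityʳ (D * L)) ⟩
    D * L
      ∎
    where
    open ≤-Reasoning
    Factorisation : ℕ → ℕ → Set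
    Factorisation x i = suc i ∣ suc x × Coprime (suc x ℕ./ suc i) L
    factorisation? : ∀ x → Decidable (Factorisation x)
    factorisation? x i = (suc i ∣? suc x) ×-dec coprime? (suc x ℕ./ suc i) L
    unique : ∀ {x} i j → i < N → j < N → Factorisation x i → Factorisation x j → i ≡ j
    unique {x} i j i<N j<N (i∣x , i⊥L) (j∣x , j⊥L) = suc-injective (∣-antisym
      (smoothPart-∣ (suc x ℕ./ suc i) i<N j⊥L (trans (m/n*n≡m i∣x) (sym (m/n*n≡m j∣x))))
      (smoothPart-∣ (suc x ℕ./ suc j) j<N i⊥L (trans (m/n*n≡m j∣x) (sym (m/n*n≡m i∣x)))))
    -- Write a multiple of `suc i` up to `D * L` as `k * suc i`. Then `k` runs through `D / suc i`
    -- full periods of coprimality to `L`, each of which contributes `φ L`.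
    block : ∀ i → i < N → D ℕ./ suc i * φ L ≡ ∑ (D * L) (λ x → indicator (factorisation? x i))
    block i i<N = begin-equality
      D ℕ./ suc i * φ L
        ≡⟨ ∑-coprimeTo (D ℕ./ suc i) L ⟨
      ∑ (D ℕ./ suc i * L) (coprimeTo L ∘ suc)
        ≡⟨ ∑-cong (D ℕ./ suc i * L) (λ k _ → cong (coprimeTo L) (m*n/n≡m (suc k) (suc i))) ⟨
      ∑ (D ℕ./ suc i * L) (λ k → coprimeTo L (suc k * suc i ℕ./ suc i))
        ≡⟨ ∑-multiples (suc i) (D ℕ./ suc i * L) (λ x → coprimeTo L (x ℕ./ suc i)) ⟨
      ∑ (D ℕ./ suc i * L * suc i) (λ x → indicator (suc i ∣? suc x) * coprimeTo L (suc x ℕ./ suc i))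
        ≡⟨ ∑-cong (D ℕ./ suc i * L * suc i) (λ x _ → indicator-× (suc i ∣? suc x) (coprime? (suc x ℕ./ suc i) L)) ⟩
      ∑ (D ℕ./ suc i * L * suc i) (λ x → indicator (factorisation? x i))
        ≡⟨ cong (λ n → ∑ n (λ x → indicator (factorisation? x i))) (rearrange (D ℕ./ suc i) L (suc i)) ⟩
      ∑ (D ℕ./ suc i * suc i * L) (λ x → indicator (factorisation? x i))
        ≡⟨ cong (λ n → ∑ (n * L) (λ x → indicator (factorisation? x i))) (m/n*n≡m (n∣D i<N)) ⟩
      ∑ (D * L) (λ x → indicator (factorisation? x i))
        ∎
      where
      rearrange : ∀ a b c → a * b * c ≡ a * c * b
      rearrange = solve-∀

-- Oresme's argument, scaled by `D`: each dyadic block `M < n ≤ 2 * M` of the harmonic sum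
-- contributes at least 1/2. Rounding in `D / n` does no harm, since the term `D / (2 * M)` compared
-- with is exact.
harmonic : ∀ k D → 2 ^ k ∣ D → k * D ≤ 2 * ∑ (2 ^ k) (λ i → D ℕ./ suc i)
harmonic zero    D _      = z≤n
harmonic (suc k) D 2M∣D = begin
  D + k * D
    ≡⟨ +-comm D (k * D) ⟩
  k * D + D
    ≤⟨ +-mono-≤ (harmonic k D (∣-trans (n∣m*n 2) 2M∣D)) half ⟩
  2 * ∑ M (λ i → D ℕ./ suc i) + 2 * ∑ M (λ i → D ℕ./ suc (M + i))
    ≡⟨ *-distribˡ-+ 2 (∑ M (λ i → D ℕ./ suc i)) _ ⟨
  2 * (∑ M (λ i → D ℕ./ suc i) + ∑ M (λ i → D ℕ./ suc (M + i)))
    ≡⟨ cong (2 *_) (∑-+ M M (λ i → D ℕ./ suc i)) ⟨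
  2 * ∑ (M + M) (λ i → D ℕ./ suc i)
    ≡⟨ cong (λ n → 2 * ∑ (M + n) (λ i → D ℕ./ suc i)) (+-identityʳ M) ⟨
  2 * ∑ (2 * M) (λ i → D ℕ./ suc i)
    ∎
  where
  open ≤-Reasoning
  M : ℕ
  M = 2 ^ k
  instance
    2M≢0 : NonZero (2 * M)
    2M≢0 = m^n≢0 2 (suc k)
  half : D ≤ 2 * ∑ M (λ i → D ℕ./ suc (M + i))
  half = begin
    D                                    ≡⟨ m*[n/m]≡n 2M∣D ⟨
    2 * M * (D ℕ./ (2 * M))                ≡⟨ *-assoc 2 M _ ⟩
    2 * (M * (D ℕ./ (2 * M)))              ≡⟨ cong (2 *_) (∑-const M _) ⟨
    2 * ∑ M (λ _ → D ℕ./ (2 * M))          ≤⟨ *-monoʳ-≤ 2 (∑-mono-≤ M (λ i i<M → /-monoʳ-≤ D (bound i i<M))) ⟩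
    2 * ∑ M (λ i → D ℕ./ suc (M + i))      ∎
    where
    bound : ∀ i → i < M → suc (M + i) ≤ 2 * M
    bound i i<M = begin
      suc (M + i)    ≡⟨ +-suc M i ⟨
      M + suc i      ≤⟨ +-monoʳ-≤ M i<M ⟩
      M + M          ≡⟨ cong (M +_) (+-identityʳ M) ⟨
      2 * M          ∎

-- Products over the primes in an interval

-- The product of f (q - 1) over the primes q with K < q ≤ K + j.
primeProduct : (ℕ → ℕ) → ℕ → ℕ → ℕ
primeProduct f K zero    = 1
primeProduct f K (suc j) with prime? (suc (K + j))
... | yes _ = primeProduct f K j * f (K + j)
... | no  _ = primeProduct f K j

-- The quotient `∏[p-1] K j / ∏p K j` is the product of `1 - 1/q` over the primes `K < q ≤ K + j`.
-- Numerator and denominator are kept apart so that all estimates stay in ℕ.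
∏p ∏[p-1] : ℕ → ℕ → ℕ
∏p     = primeProduct suc
∏[p-1] = primeProduct id

∏p≢0 : ∀ K j → NonZero (∏p K j)
∏p≢0 K zero = _
∏p≢0 K (suc j) with prime? (suc (K + j))
... | yes _ = m*n≢0 (∏p K j) (suc (K + j)) {{∏p≢0 K j}}
... | no  _ = ∏p≢0 K j

prime∤∏p : ∀ K j {q} → Prime q → K + j < q → ¬ q ∣ ∏p K j
prime∤∏p K zero q-prime _ q∣1 = ¬prime[1] (subst Prime (∣1⇒≡1 q∣1) q-prime)
prime∤∏p K (suc j) {q} q-prime K+1+j<q with prime? (suc (K + j))
... | yes _ = λ q∣ → [ prime∤∏p K j q-prime K+j<q , >⇒∤ 1+K+j<q ]′ (euclidsLemma _ _ q-prime q∣)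
  where
  1+K+j<q : suc (K + j) < q
  1+K+j<q = subst (_< q) (+-suc K j) K+1+j<q
  K+j<q : K + j < q
  K+j<q = <-trans (n<1+n (K + j)) 1+K+j<q
... | no  _ = prime∤∏p K j q-prime (<-trans (+-monoʳ-< K (n<1+n j)) K+1+j<q)

n∣n! : ∀ n .{{_ : NonZero n}} → n ∣ n !
n∣n! (suc n) = m∣m*n (n !)

-- The factor `K !` supplies the primes up to `K`, so that `K ! * ∏p K j` can serve as `L` in
-- `∑-/-*-φ≤`.
prime∣!*∏p : ∀ K j {q} → Prime q → q ≤ K + j → q ∣ K ! * ∏p K j
prime∣!*∏p K zero {q} q-prime q≤K+0 = ∣m⇒∣m*n 1
  (∣-trans (n∣n! q {{prime⇒nonZero q-prime}}) (m≤n⇒m!∣n! (subst (q ≤_) (+-identityʳ K) q≤K+0)))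
prime∣!*∏p K (suc j) {q} q-prime q≤K+1+j
  with prime? (suc (K + j)) | m≤n⇒m<n∨m≡n (subst (q ≤_) (+-suc K j) q≤K+1+j)
... | yes _ | inj₁ q<1+K+j = ∣-trans (prime∣!*∏p K j q-prime (s≤s⁻¹ q<1+K+j)) (*-monoʳ-∣ (K !) (m∣m*n _))
... | no  _ | inj₁ q<1+K+j = prime∣!*∏p K j q-prime (s≤s⁻¹ q<1+K+j)
... | yes _ | inj₂ refl    = ∣n⇒∣m*n (K !) (n∣m*n (∏p K j))
... | no ¬p | inj₂ refl    = contradiction q-prime ¬p

prime∤! : ∀ n {q} → Prime q → n < q → ¬ q ∣ n !
prime∤! zero    q-prime _     q∣1   = ¬prime[1] (subst Prime (∣1⇒≡1 q∣1) q-prime)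
prime∤! (suc n) q-prime 1+n<q q∣n+1! =
  [ >⇒∤ 1+n<q , prime∤! n q-prime (<-trans (n<1+n n) 1+n<q) ]′ (euclidsLemma (suc n) (n !) q-prime q∣n+1!)

-- All prime factors of `s` are at most `K`, so every prime of the product is new when it is
-- adjoined and `φ-*-prime` applies. The lemma serves for `s = K !` and for `s = 6`.
φ-*-∏p : ∀ {s} K j → s ∣ K ! → φ (s * ∏p K j) ≡ φ s * ∏[p-1] K j
φ-*-∏p {s} K zero    s∣K! = trans (cong φ (*-identityʳ s)) (sym (*-identityʳ (φ s)))
φ-*-∏p {s} K (suc j) s∣K! with prime? (suc (K + j))
... | no  _       = φ-*-∏p K j s∣K!
... | yes q-prime = begin
  φ (s * (∏p K j * q))             ≡⟨ cong φ (*-assoc s (∏p K j) q) ⟨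
  φ (s * ∏p K j * q)               ≡⟨ φ-*-prime q-prime q∤ ⟩
  φ (s * ∏p K j) * (K + j)         ≡⟨ cong (_* (K + j)) (φ-*-∏p K j s∣K!) ⟩
  φ s * ∏[p-1] K j * (K + j)       ≡⟨ *-assoc (φ s) (∏[p-1] K j) (K + j) ⟩
  φ s * (∏[p-1] K j * (K + j))     ∎
  where
  open ≡-Reasoning
  q : ℕ
  q = suc (K + j)
  q∤ : ¬ q ∣ s * ∏p K j
  q∤ q∣ = [ (λ q∣s → prime∤! K q-prime (s≤s (m≤m+n K j)) (∣-trans q∣s s∣K!))
          , prime∤∏p K j q-prime (n<1+n (K + j)) ]′ (euclidsLemma s (∏p K j) q-prime q∣)

-- The harmonic sum up to `j = 2 ^ k` is at least `k / 2` and at most `L / φ L`. As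
-- `φ L ≥ ∏[p-1] K j`, this gives `k * ∏[p-1] K j ≤ 2 * K ! * ∏p K j`.
∏[p-1]/∏p-vanishes : ∀ K C → ∃[ j ] ∏[p-1] K j * C ≤ ∏p K j
∏[p-1]/∏p-vanishes K C = j , *-cancelˡ-≤ (D * (2 * K !)) (begin
  D * (2 * K !) * (∏[p-1] K j * C)
    ≡⟨ rearrange₁ D (K !) C (∏[p-1] K j) ⟩
  k * D * (1 * ∏[p-1] K j)
    ≤⟨ *-monoʳ-≤ (k * D) (*-monoˡ-≤ (∏[p-1] K j) (>-nonZero⁻¹ (φ (K !)) {{φ-nonZero (K !)}})) ⟩
  k * D * (φ (K !) * ∏[p-1] K j)
    ≡⟨ cong (k * D *_) (φ-*-∏p K j ∣-refl) ⟨
  k * D * φ L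
    ≤⟨ *-monoˡ-≤ (φ L) (harmonic k D (n∣n! j)) ⟩
  2 * ∑ j (λ i → D ℕ./ suc i) * φ L
    ≡⟨ *-assoc 2 (∑ j (λ i → D ℕ./ suc i)) (φ L) ⟩
  2 * (∑ j (λ i → D ℕ./ suc i) * φ L)
    ≤⟨ *-monoʳ-≤ 2 (∑-/-*-φ≤ j L (λ p-prime p≤j → prime∣!*∏p K j p-prime (≤-trans p≤j (m≤n+m j K))) D 1+n∣D) ⟩
  2 * (D * L)
    ≡⟨ rearrange₂ D (K !) (∏p K j) ⟩
  D * (2 * K !) * ∏p K j
    ∎)
  where
  open ≤-Reasoning
  k j D L : ℕ
  -- This `k` absorbs the constant `2 * K !` and leaves `C`. The factorial `D` clears the
  -- denominators `1, ..., j` of the harmonic sum.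
  k = 2 * K ! * C
  j = 2 ^ k
  D = j !
  L = K ! * ∏p K j
  instance
    _ = K !≢0
    _ = j !≢0
    _ = m^n≢0 2 k
    _ = m*n≢0 2 (K !)
    _ = m*n≢0 D (2 * K !)
  1+n∣D : ∀ {n} → n < j → suc n ∣ D
  1+n∣D n<j = ∣-trans (n∣n! _) (m≤n⇒m!∣n! n<j)
  rearrange₁ : ∀ D f C Q → D * (2 * f) * (Q * C) ≡ 2 * f * C * D * (1 * Q)
  rearrange₁ = solve-∀
  rearrange₂ : ∀ D f P → 2 * (D * (f * P)) ≡ D * (2 * f) * P
  rearrange₂ = solve-∀

-- Partial products in a prescribed interval

-- Beyond K the factors 1 - 1/q are too close to 1 for the partial products to
-- jump over the interval (u / v , β / w], whose left end is below the initial
-- value 1/3.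
module _ (u v β w K : ℕ) .{{_ : NonZero v}} .{{_ : NonZero w}} .{{_ : NonZero β}} .{{_ : NonZero K}}
         (uw<βv : u * w < β * v) (3u<v : 3 * u < v) (uw≤K : u * w ≤ K) where

  -- With denominators cleared, `u / v < ∏[p-1] / (3 * ∏p)` and `∏[p-1] / (3 * ∏p) ≤ β / w`.
  Above Below : ℕ → Set
  Above j = 3 * ∏p K j * u < ∏[p-1] K j * v
  Below j = ∏[p-1] K j * w ≤ 3 * ∏p K j * β

  -- If `suc (K + j)` is not prime, the products do not change. Otherwise put `n = K + j`: from
  -- `u * w + 1 ≤ β * v` and `u * w ≤ n` follows `u / v ≤ (β / w) * n / (n + 1)`, so the factor
  -- `n / (n + 1)` cannot carry a value above `β / w` down to `u / v`.
  above-suc : ∀ j → ¬ Below j → ¬ Below (suc j) ⊎ Above (suc j)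
  above-suc j ¬below with prime? (suc (K + j))
  ... | no  _ = inj₁ ¬below
  ... | yes _ = inj₂ (*-cancelʳ-< w _ _ (begin-strict
    3 * (P * suc n) * u * w       ≡⟨ rearrange₁ P n u w ⟩
    3 * P * (u * w * n + u * w)   ≤⟨ *-monoʳ-≤ (3 * P) (+-monoʳ-≤ (u * w * n) (≤-trans uw≤K (m≤m+n K j))) ⟩
    3 * P * (u * w * n + n)       ≡⟨ cong (3 * P *_) (+-comm (u * w * n) n) ⟩
    3 * P * (suc (u * w) * n)     ≤⟨ *-monoʳ-≤ (3 * P) (*-monoˡ-≤ n uw<βv) ⟩
    3 * P * (β * v * n)           ≡⟨ rearrange₂ (3 * P) β v n ⟩
    3 * P * β * (n * v)           <⟨ *-monoˡ-< (n * v) (≰⇒> ¬below) ⟩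
    Q * w * (n * v)               ≡⟨ rearrange₃ Q n v w ⟩
    Q * n * v * w                 ∎))
    where
    open ≤-Reasoning
    n P Q : ℕ
    n = K + j
    P = ∏p K j
    Q = ∏[p-1] K j
    instance
      n≢0 : NonZero n
      n≢0 = >-nonZero (<-≤-trans (>-nonZero⁻¹ K) (m≤m+n K j))
      _ = m*n≢0 n v
    rearrange₁ : ∀ P n u w → 3 * (P * suc n) * u * w ≡ 3 * P * (u * w * n + u * w)
    rearrange₁ = solve-∀
    rearrange₂ : ∀ a β v n → a * (β * v * n) ≡ a * β * (n * v)
    rearrange₂ = solve-∀
    rearrange₃ : ∀ Q n v w → Q * w * (n * v) ≡ Q * n * v * w
    rearrange₃ = solve-∀

  -- The descent from `j` ends either at 0, where both products are 1 and `Above` is `3 * u < v`, or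
  -- at an index whose predecessor violates `Below`, where `above-suc` applies.
  first-below : ∀ j → Below j → ∃[ i ] (Above i × Below i)
  first-below zero below = 0 , above₀ , below
    where
    above₀ : 3 * u < 1 * v
    above₀ = subst (3 * u <_) (sym (*-identityˡ v)) 3u<v
  first-below (suc j) below with ∏[p-1] K j * w ≤? 3 * ∏p K j * β
  ... | yes below′ = first-below j below′
  ... | no  ¬below = suc j , [ contradiction below , id ]′ (above-suc j ¬below) , below

  ∏[p-1]/3∏p-between : ∃[ i ] (Above i × Below i)
  -- A product of at most `1 / w` is small enough because `β ≥ 1`.
  ∏[p-1]/3∏p-between with j , Qw≤P ← ∏[p-1]/∏p-vanishes K w = first-below j (begin
    ∏[p-1] K j * w      ≤⟨ Qw≤P ⟩
    ∏p K j              ≤⟨ m≤n*m (∏p K j) 3 ⟩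
    3 * ∏p K j          ≤⟨ m≤m*n (3 * ∏p K j) β ⟩
    3 * ∏p K j * β      ∎)
    where open ≤-Reasoning

-- Dickson's conjecture for the forms t, ct - 1, ct + 1

open import Data.Integer.Base using (+_)

-- Matching on a successor lets the positivity of the leading coefficient hold by computation.
linear : (c : ℕ) .{{_ : NonZero c}} → ℤ → LinearPoly
linear c@(suc _) d = record { leading = + c ; constant = d ; leading-positive = _ }

eval-linear : ∀ c .{{_ : NonZero c}} d t → eval t (linear c d) ≡ + c ℤ.* t ℤ.+ d
eval-linear (suc _) d t = refl

inverse-mod : ∀ {q c} → Coprime q c → ∃[ x ] ∃[ y ] (+ c ℤ.* x ≡ ℤ.1ℤ ℤ.+ + q ℤ.* y)
inverse-mod {q} {c} q⊥c with coprime-Bézout q⊥c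
... | Bézout.-+ y x 1+yq≡xc = + x , + y , (begin
  + c ℤ.* + x               ≡⟨ ℤ.pos-* c x ⟨
  + (c * x)                 ≡⟨ cong +_ (trans (*-comm c x) (trans (sym 1+yq≡xc) (cong suc (*-comm y q)))) ⟩
  ℤ.1ℤ ℤ.+ + (q * y)        ≡⟨ cong (ℤ._+_ ℤ.1ℤ) (ℤ.pos-* q y) ⟩
  ℤ.1ℤ ℤ.+ + q ℤ.* + y      ∎)
  where open ≡-Reasoning
... | Bézout.+- y x 1+xc≡yq = ℤ.- + x , ℤ.- + y , (begin
  + c ℤ.* ℤ.- + x                                            ≡⟨ negate (+ c) (+ x) ⟩
  ℤ.1ℤ ℤ.- (ℤ.1ℤ ℤ.+ + x ℤ.* + c)                            ≡⟨ cong (ℤ._-_ ℤ.1ℤ) eq ⟩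
  ℤ.1ℤ ℤ.- + y ℤ.* + q                                       ≡⟨ reorder (+ y) (+ q) ⟩
  ℤ.1ℤ ℤ.+ + q ℤ.* ℤ.- + y                                   ∎)
  where
  open ≡-Reasoning
  eq : ℤ.1ℤ ℤ.+ + x ℤ.* + c ≡ + y ℤ.* + q
  eq = trans (cong (ℤ._+_ ℤ.1ℤ) (sym (ℤ.pos-* x c))) (trans (cong +_ 1+xc≡yq) (ℤ.pos-* y q))
  negate : ∀ c x → c ℤ.* ℤ.- x ≡ ℤ.1ℤ ℤ.- (ℤ.1ℤ ℤ.+ x ℤ.* c)
  negate = ℤSolver.solve-∀
  reorder : ∀ y q → ℤ.1ℤ ℤ.- y ℤ.* q ≡ ℤ.1ℤ ℤ.+ q ℤ.* ℤ.- y
  reorder = ℤSolver.solve-∀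

module _ (c : ℕ) .{{_ : NonZero c}} where

  twinFamily : List LinearPoly
  twinFamily = linear 1 (+ 0) ∷ linear c -[1+ 0 ] ∷ linear c (+ 1) ∷ []

  evalProduct-twinFamily : ∀ t →
    evalProduct t twinFamily ≡ t ℤ.* ((+ c ℤ.* t) ℤ.* (+ c ℤ.* t) ℤ.- ℤ.1ℤ)
  evalProduct-twinFamily t rewrite eval-linear c -[1+ 0 ] t | eval-linear c (+ 1) t = expand (+ c) t
    where
    expand : ∀ c t →
      (+ 1 ℤ.* t ℤ.+ + 0) ℤ.* ((c ℤ.* t ℤ.+ -[1+ 0 ]) ℤ.* ((c ℤ.* t ℤ.+ + 1) ℤ.* + 1)) ≡
      t ℤ.* ((c ℤ.* t) ℤ.* (c ℤ.* t) ℤ.- + 1)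
    expand = ℤSolver.solve-∀

  -- If q ∣ c, the product at t = 1 is -1 modulo q; otherwise, at t = 2 / c
  -- modulo q, c times the product is 2 * (2 ^ 2 - 1) = 6.
  twinFamily-nonvanishing : 6 ∣ c → ∀ q → Prime q → ∃[ t ] ¬ + q Unsigned.∣ evalProduct t twinFamily
  twinFamily-nonvanishing 6∣c q q-prime with q ∣? c
  ... | yes q∣c = ℤ.1ℤ , λ q∣f → ¬prime[1] (subst Prime (∣1⇒≡1 (∣⇒∣ᵤ (q∣1 (∣ᵤ⇒∣ q∣f)))) q-prime)
    where
    difference : ∀ c → c ℤ.* c ℤ.- ℤ.1ℤ ℤ.* ((c ℤ.* ℤ.1ℤ) ℤ.* (c ℤ.* ℤ.1ℤ) ℤ.- ℤ.1ℤ) ≡ ℤ.1ℤ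
    difference = ℤSolver.solve-∀
    q∣1 : + q Signed.∣ evalProduct ℤ.1ℤ twinFamily → + q Signed.∣ ℤ.1ℤ
    q∣1 q∣f rewrite evalProduct-twinFamily ℤ.1ℤ = subst (+ q Signed.∣_) (difference (+ c))
      (Signed.∣m∣n⇒∣m-n (Signed.∣m⇒∣m*n {m = + c} (+ c) (∣ᵤ⇒∣ q∣c)) q∣f)
  ... | no q∤c with x , y , cx≡1+qy ← inverse-mod (prime∤⇒coprime q-prime q∤c) =
    + 2 ℤ.* x , λ q∣f → q∤c (∣-trans (∣⇒∣ᵤ (q∣6 (∣ᵤ⇒∣ q∣f))) 6∣c)
    where
    -- At `t = 2 * x` one has `c * t = 2 * (1 + z)`, so `c` times the product is
    -- `8 * (1 + z) ^ 3 - 2 * (1 + z) = 6 + r`, where `q` divides `r`. Thus `q` would divide 6, and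
    -- hence `c`.
    z r : ℤ
    z = + q ℤ.* y
    r = z ℤ.* (+ 8 ℤ.* z ℤ.* z ℤ.+ + 24 ℤ.* z ℤ.+ + 22)
    scale : ∀ c x → c ℤ.* ((+ 2 ℤ.* x) ℤ.* ((c ℤ.* (+ 2 ℤ.* x)) ℤ.* (c ℤ.* (+ 2 ℤ.* x)) ℤ.- ℤ.1ℤ))
                    ≡ + 2 ℤ.* (c ℤ.* x) ℤ.* ((+ 2 ℤ.* (c ℤ.* x)) ℤ.* (+ 2 ℤ.* (c ℤ.* x)) ℤ.- ℤ.1ℤ)
    scale = ℤSolver.solve-∀
    difference : ∀ z → + 2 ℤ.* (ℤ.1ℤ ℤ.+ z) ℤ.* ((+ 2 ℤ.* (ℤ.1ℤ ℤ.+ z)) ℤ.* (+ 2 ℤ.* (ℤ.1ℤ ℤ.+ z)) ℤ.- ℤ.1ℤ)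
                 ℤ.- z ℤ.* (+ 8 ℤ.* z ℤ.* z ℤ.+ + 24 ℤ.* z ℤ.+ + 22) ≡ + 6
    difference = ℤSolver.solve-∀
    q∣6 : + q Signed.∣ evalProduct (+ 2 ℤ.* x) twinFamily → + q Signed.∣ + 6
    q∣6 q∣f rewrite evalProduct-twinFamily (+ 2 ℤ.* x) = subst (+ q Signed.∣_)
      (trans (cong (ℤ._- r) (trans (scale (+ c) x)
        (cong (λ a → + 2 ℤ.* a ℤ.* ((+ 2 ℤ.* a) ℤ.* (+ 2 ℤ.* a) ℤ.- ℤ.1ℤ)) cx≡1+qy))) (difference z))
      (Signed.∣m∣n⇒∣m-n (Signed.∣n⇒∣m*n (+ c) q∣f) (Signed.∣m⇒∣m*n _ (Signed.∣m⇒∣m*n y Signed.∣-refl)))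

  dickson⇒twins : DicksonConjecture → 6 ∣ c → ∀ N →
    ∃[ t ] ∃[ p ] (N < t × Prime t × Prime p × Prime (p + 2) × p + 1 ≡ c * t)
  dickson⇒twins dickson 6∣c N
    with t , N<t , (n , t≡n , n-prime) ∷ (p , ct-1≡p , p-prime) ∷ (p′ , ct+1≡p′ , p′-prime) ∷ []
      ← dickson twinFamily (twinFamily-nonvanishing 6∣c) N =
    t , p , N<t
    , subst Prime (sym (ℤ.+-injective (trans (sym (identity (+ t))) t≡n))) n-prime
    , p-prime
    , subst Prime (sym p+2≡p′) p′-prime
    , p+1≡ct
    where
    identity : ∀ t → + 1 ℤ.* t ℤ.+ + 0 ≡ t
    identity = ℤSolver.solve-∀
    cancel : ∀ a → (a ℤ.+ -[1+ 0 ]) ℤ.+ + 1 ≡ a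
    cancel = ℤSolver.solve-∀
    p+1≡ct : p + 1 ≡ c * t
    p+1≡ct = ℤ.+-injective (begin
      + p ℤ.+ + 1                               ≡⟨ cong (ℤ._+ + 1) (trans (sym (eval-linear c _ _)) ct-1≡p) ⟨
      (+ c ℤ.* + t ℤ.+ -[1+ 0 ]) ℤ.+ + 1        ≡⟨ cancel (+ c ℤ.* + t) ⟩
      + c ℤ.* + t                               ≡⟨ ℤ.pos-* c t ⟨
      + (c * t)                                 ∎)
      where open ≡-Reasoning
    p+2≡p′ : p + 2 ≡ p′
    p+2≡p′ = ℤ.+-injective (begin
      + (p + 2)                                 ≡⟨ cong +_ (+-assoc p 1 1) ⟨
      + (p + 1 + 1)                             ≡⟨ cong (λ n → + (n + 1)) p+1≡ct ⟩
      + (c * t) ℤ.+ + 1                         ≡⟨ cong (ℤ._+ + 1) (ℤ.pos-* c t) ⟩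
      + c ℤ.* + t ℤ.+ + 1                       ≡⟨ trans (sym (eval-linear c _ _)) ct+1≡p′ ⟩
      + p′                                      ∎)
      where open ≡-Reasoning

-- Bounds for the totient ratio

module _ {m F u v s d : ℕ} (d+2≡6mt : d + 2 ≡ 6 * m * suc s) where

  -- In the application `d = φ p`, `suc s` is the prime `t`, and `2 * F = φ (6 * m)`, so the ratio
  -- is `2 * F * s / d`. The gap of at least 1 in `3 * m * u < F * v`, multiplied by `suc s`,
  -- outweighs the loss `F * v` from replacing `suc s` by `s`.
  ratio-lower : 3 * m * u < F * v → F * v ≤ s → u * d < 2 * F * s * v
  ratio-lower above Fv≤s = begin-strict
    u * d                             ≤⟨ *-monoʳ-≤ u (≤-trans (m≤m+n d 2) (≤-reflexive d+2≡6mt)) ⟩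
    u * (6 * m * suc s)               ≡⟨ eq₁ u m s ⟩
    2 * (3 * m * u * suc s)           <⟨ *-monoʳ-< 2 (+-cancelʳ-< (suc s) _ _ (begin-strict
      3 * m * u * suc s + suc s         ≡⟨ +-comm (3 * m * u * suc s) (suc s) ⟩
      suc (3 * m * u) * suc s           ≤⟨ *-monoˡ-≤ (suc s) above ⟩
      F * v * suc s                     ≡⟨ *-suc (F * v) s ⟩
      F * v + F * v * s                 ≤⟨ +-monoˡ-≤ (F * v * s) Fv≤s ⟩
      s + F * v * s                     <⟨ +-monoˡ-< (F * v * s) (n<1+n s) ⟩
      suc s + F * v * s                 ≡⟨ +-comm (suc s) (F * v * s) ⟩
      F * v * s + suc s                 ∎)) ⟩
    2 * (F * v * s)                   ≡⟨ eq₂ F v s ⟩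
    2 * F * s * v                     ∎
    where
    open ≤-Reasoning
    eq₁ : ∀ u m s → u * (6 * m * suc s) ≡ 2 * (3 * m * u * suc s)
    eq₁ = solve-∀
    eq₂ : ∀ F v s → 2 * (F * v * s) ≡ 2 * F * s * v
    eq₂ = solve-∀

module _ {m F β w s d : ℕ} .{{_ : NonZero m}} .{{_ : NonZero β}}
         (d+2≡6mt : d + 2 ≡ 6 * m * suc s) where

  -- Since `6 * m > 2`, the denominator `d = 6 * m * suc s - 2` exceeds `6 * m * s`; this makes the
  -- non-strict bound strict.
  ratio-upper : F * w ≤ 3 * m * β → 2 * F * s * w < β * d
  ratio-upper below = begin-strict
    2 * F * s * w             ≡⟨ eq₁ F s w ⟩
    2 * s * (F * w)           ≤⟨ *-monoʳ-≤ (2 * s) below ⟩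
    2 * s * (3 * m * β)       ≡⟨ eq₂ s m β ⟩
    β * (6 * m * s)           <⟨ *-monoʳ-< β (+-cancelʳ-< 2 _ _ (begin-strict
      6 * m * s + 2             <⟨ +-monoʳ-< (6 * m * s) {2} {6} (s<s (s<s z<s)) ⟩
      6 * m * s + 6             ≤⟨ +-monoʳ-≤ (6 * m * s) (m≤m*n 6 m) ⟩
      6 * m * s + 6 * m         ≡⟨ +-comm (6 * m * s) (6 * m) ⟩
      6 * m + 6 * m * s         ≡⟨ *-suc (6 * m) s ⟨
      6 * m * suc s             ≡⟨ d+2≡6mt ⟨
      d + 2                     ∎)) ⟩
    β * d                     ∎
    where
    open ≤-Reasoning
    eq₁ : ∀ F s w → 2 * F * s * w ≡ 2 * s * (F * w)
    eq₁ = solve-∀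
    eq₂ : ∀ s m β → 2 * s * (3 * m * β) ≡ β * (6 * m * s)
    eq₂ = solve-∀

dickson⇒twin-φ : DicksonConjecture → ∀ m .{{_ : NonZero m}} N →
  ∃[ s ] ∃[ p ] (N ≤ s × Prime p × Prime (p + 2) × φ (p + 1) ≡ φ (6 * m) * s × φ p + 2 ≡ 6 * m * suc s)
-- The bound `c + N` ensures both `t > c`, so that the prime `t` does not divide `c`, and
-- `t - 1 ≥ N`.
dickson⇒twin-φ dickson m N = unpack (dickson⇒twins c {{c≢0}} dickson (m∣m*n m) (c + N))
  where
  c : ℕ
  c = 6 * m
  c≢0 : NonZero c
  c≢0 = m*n≢0 6 m
  unpack : ∃[ t ] ∃[ p ] (c + N < t × Prime t × Prime p × Prime (p + 2) × p + 1 ≡ c * t) →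
    ∃[ s ] ∃[ p ] (N ≤ s × Prime p × Prime (p + 2) × φ (p + 1) ≡ φ c * s × φ p + 2 ≡ c * suc s)
  unpack (suc s , zero , _ , _ , p-prime , _) = contradiction p-prime ¬prime[0]
  unpack (t@(suc s) , p@(suc d) , N<t , t-prime , p-prime , p+2-prime , p+1≡ct) =
    s , p , ≤-trans (m≤n+m N c) (s≤s⁻¹ N<t) , p-prime , p+2-prime
    , trans (cong φ p+1≡ct) (φ-*-prime t-prime t∤c)
    , trans (cong (_+ 2) (φ-prime p-prime)) (trans (+-suc d 1) p+1≡ct)
    where
    t∤c : ¬ t ∣ c
    t∤c = >⇒∤ {{c≢0}} (≤-<-trans (m≤m+n c N) N<t)

twinRatio-between : DicksonConjecture → ∀ u v β w →
  .{{_ : NonZero v}} .{{_ : NonZero w}} .{{_ : NonZero β}} →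
  u * w < β * v → 3 * u < v →
  ∃[ p ] (Prime p × Prime (p + 2) × u * φ p < φ (p + 1) * v × φ (p + 1) * w < β * φ p)
twinRatio-between dickson u v β w uw<βv 3u<v =
  let j , above , below = ∏[p-1]/3∏p-between u v β w K uw<βv 3u<v (m≤m+n (u * w) 3)
      m = ∏p K j
      F = ∏[p-1] K j
      instance m≢0 = ∏p≢0 K j
      -- The number 6 is `3 !`, a divisor of `K !`, and `φ 6` evaluates to 2.
      φ[6m]≡2F = φ-*-∏p {6} K j (m≤n⇒m!∣n! {3} (m≤n+m 3 (u * w)))
      s , p , Fv≤s , p-prime , p+2-prime , φ[p+1]≡ , φ[p]+2≡ = dickson⇒twin-φ dickson m (F * v)
      φ[p+1]≡2Fs = trans φ[p+1]≡ (cong (_* s) φ[6m]≡2F)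
  in p , p-prime , p+2-prime
     , subst (λ n → u * φ p < n * v) (sym φ[p+1]≡2Fs) (ratio-lower {m} {F} φ[p]+2≡ above Fv≤s)
     , subst (λ n → n * w < β * φ p) (sym φ[p+1]≡2Fs) (ratio-upper {m} {F} φ[p]+2≡ below)
  where
  K : ℕ
  -- The summand `u * w` makes the steps small; the summand 3 keeps the primes 2 and 3 of the factor
  -- 6 out of the product.
  K = u * w + 3
  instance
    K≢0 : NonZero K
    K≢0 = >-nonZero (m≤n⇒m≤o+n (u * w) z<s)

-- Passage to rational and real intervals

-- As `n / d` is stored in lowest terms, the comparison is made with the unnormalised fraction,
-- which avoids the gcd.
<-/ : ∀ a n d .{{_ : NonZero d}} → ↥ a ℤ.* + d ℤ.< n ℤ.* ↧ a → a ℚ.< n / d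
<-/ a@record{} n d@(suc d-1) lt =
  toℚᵘ-cancel-< (ℚᵘ.<-respʳ-≃ (ℚᵘ.≃-sym (toℚᵘ-fromℚᵘ (mkℚᵘ n d-1))) (*<* lt))

/-< : ∀ b n d .{{_ : NonZero d}} → n ℤ.* ↧ b ℤ.< ↥ b ℤ.* + d → n / d ℚ.< b
/-< b@record{} n d@(suc d-1) lt =
  toℚᵘ-cancel-< (ℚᵘ.<-respˡ-≃ (ℚᵘ.≃-sym (toℚᵘ-fromℚᵘ (mkℚᵘ n d-1))) (*<* lt))

/-between : ∀ a b {u β} n d .{{_ : NonZero d}} → ↥ a ℤ.≤ + u → ↥ b ≡ + β →
  u * d < n * ↧ₙ a → n * ↧ₙ b < β * d → a ℚ.< + n / d × + n / d ℚ.< b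
/-between a b {u} {β} n d ↥a≤u ↥b≡β above below =
    <-/ a (+ n) d (ℤ.≤-<-trans (ℤ.*-monoʳ-≤-nonNeg (+ d) ↥a≤u) (pos-<-pos u d n (↧ₙ a) above))
  , /-< b (+ n) d (subst (λ i → + n ℤ.* ↧ b ℤ.< i ℤ.* + d) (sym ↥b≡β) (pos-<-pos n (↧ₙ b) β d below))
  where
  pos-<-pos : ∀ i j k l → i * j < k * l → + i ℤ.* + j ℤ.< + k ℤ.* + l
  pos-<-pos i j k l lt = subst₂ ℤ._<_ (ℤ.pos-* i j) (ℤ.pos-* k l) (ℤ.+<+ lt)

totientRatio-between : ∀ {p} (p-prime : Prime p) a b {u β} → ↥ a ℤ.≤ + u → ↥ b ≡ + β →
  u * φ p < φ (p + 1) * ↧ₙ a → φ (p + 1) * ↧ₙ b < β * φ p →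
  a ℚ.< totientRatio p p-prime × totientRatio p p-prime ℚ.< b
totientRatio-between {p} p-prime a b =
  /-between a b (φ (p + 1)) (φ p) {{φ-nonZero p {{prime⇒nonZero p-prime}}}}

-- A negative left end gives way to 0 over the same denominator, which is still below `b` and below
-- 1/3.
nonNegative-numerator : ∀ a b → a ℚ.< b → 0ℚ ℚ.< b → a ℚ.< + 1 / 3 →
  ∃[ u ] (↥ a ℤ.≤ + u × + u ℤ.* ↧ b ℤ.< ↥ b ℤ.* ↧ a × 3 * u < ↧ₙ a)
nonNegative-numerator a@(mkℚ (+ u) v-1 _) b (ℚ.*<* a<b) _ (ℚ.*<* a<⅓) =
  u , ℤ.≤-refl , a<b , ℤ.drop‿+<+
    (subst₂ ℤ._<_ (trans (sym (ℤ.pos-* u 3)) (cong +_ (*-comm u 3))) (ℤ.*-identityˡ (↧ a)) a<⅓)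
nonNegative-numerator a@(mkℚ -[1+ _ ] v-1 _) b@(mkℚ β _ _) _ (ℚ.*<* 0<b) _ =
  0 , ℤ.-≤+ , 0<βv , z<s
  where
  0<βv : + 0 ℤ.< β ℤ.* ↧ a
  0<βv = ℤ.*-monoʳ-<-pos (↧ a) (subst (+ 0 ℤ.<_) (ℤ.*-identityʳ β) 0<b)

interval-hits : DicksonConjecture → ∀ a b → a ℚ.< b → 0ℚ ℚ.< b → a ℚ.< + 1 / 3 →
  ∃[ s ] (s ∈ TwinPrimeTotientRatios × a ℚ.< s × s ℚ.< b)
interval-hits dickson a b@(mkℚ -[1+ _ ] _ _) a<b 0<b a<⅓ = contradiction 0<b λ { (ℚ.*<* ()) }
interval-hits dickson a b@(mkℚ (+ zero) _ _) a<b 0<b a<⅓ = contradiction 0<b λ { (ℚ.*<* (ℤ.+<+ ())) }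
interval-hits dickson a b@(mkℚ (+ β@(suc _)) _ _) a<b 0<b a<⅓ = hit (nonNegative-numerator a b a<b 0<b a<⅓)
  where
  ratio : ∀ {u} → ↥ a ℤ.≤ + u →
    ∃[ p ] (Prime p × Prime (p + 2) × u * φ p < φ (p + 1) * ↧ₙ a × φ (p + 1) * ↧ₙ b < β * φ p) →
    ∃[ s ] (s ∈ TwinPrimeTotientRatios × a ℚ.< s × s ℚ.< b)
  ratio ↥a≤u (p , p-prime , p+2-prime , above , below) =
    totientRatio p p-prime , (p , p-prime , p+2-prime , refl)
    , totientRatio-between p-prime a b ↥a≤u refl above below
  hit : ∃[ u ] (↥ a ℤ.≤ + u × + u ℤ.* ↧ b ℤ.< ↥ b ℤ.* ↧ a × 3 * u < ↧ₙ a) →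
    ∃[ s ] (s ∈ TwinPrimeTotientRatios × a ℚ.< s × s ℚ.< b)
  hit (u , ↥a≤u , uw<βv , 3u<v) = ratio ↥a≤u (twinRatio-between dickson u (↧ₙ a) β (↧ₙ b) (ℤ.drop‿+<+
          (subst₂ ℤ._<_ (sym (ℤ.pos-* u (↧ₙ b))) (sym (ℤ.pos-* β (↧ₙ a))) uw<βv)) 3u<v)

theorem3 : DicksonConjecture → TwinPrimeTotientRatios IsDenseIn ClosedInterval (fromℚ 0ℚ) (fromℚ (+ 1 / 3))
theorem3 dickson x (0≤x , x≤⅓) a b a<x x<b = interval-hits dickson a b (ordered a<x x<b) 0<b (x≤⅓ a<x)
  where
  ordered : ∀ {p q} → p ∈ Lower x → q ∈ Upper x → p ℚ.< q
  ordered {p} {q} p<x x<q with ℚ.<-cmp p q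
  ... | tri< p<q _ _ = p<q
  ... | tri≈ _ refl _ = contradiction (p<x , x<q) (disjoint x)
  ... | tri> _ _ q<p = contradiction (lower-closed x q<p p<x , x<q) (disjoint x)
  0<b : 0ℚ ℚ.< b
  -- Openness of the upper cut gives `q` with `x < q < b`. If `b ≤ 0`, then `q < 0`, and `0 ≤ x`
  -- puts `q` into the lower cut as well.
  0<b with q , q<b , x<q ← upper-open x x<b with 0ℚ ℚ.<? b
  ... | yes 0<b = 0<b
  ... | no  0≮b = contradiction (0≤x (ℚ.<-≤-trans q<b (ℚ.≮⇒≥ 0≮b)) , x<q) (disjoint x)
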